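{- Suppose the natural number exo-type $\mathbb N^e$ is cofibrant, and let $N,L:\mathcal U^e$ be exo-types. If $N$ and $L$ are cofibrant, then the exo-type $\mathsf{BinTree}^e(N,L)$ of binary exo-trees with node values in $N$ and leaf values in $L$ is cofibrant. If $N$ and $L$ are sharp, then $\mathsf{BinTree}^e(N,L)$ is sharp.
   Context: Setting: two-level type theory (2LTT). There is a hierarchy of universes $\mathcal U$ whose terms are called types and which obeys homotopy type theory (with the usual $\prod,\sum,+,\mathbf 1,\mathbf 0,\mathbb N$ and identity type $=$), and a hierarchy of exo-universes $\mathcal U^e$ whose terms are called exo-types, with their own formers $\prod^e,\sum^e,+^e,\mathbf 1^e,\mathbf 0^e,\mathbb N^e$ and exo-equality $=^e$. Every type is also an exo-type. Exo-level inductive exo-types eliminate into arbitrary exo-types, while inductive types eliminate only into types. Axioms: univalence (hence function extensionality) for $=$; function extensionality and uniqueness of identity proofs for $=^e$. An exo-isomorphism $A\cong B$ of exo-types consists of $f:A\to B$, $g:B\to A$ with $f\circ g=^e\mathrm{id}_B$ and $g\circ f=^e\mathrm{id}_A$. An exo-type $A$ is fibrant if there is a type $RA:\mathcal U$ (its fibrant match) with $A\cong RA$. An exo-type $A$ is cofibrant if (1) for any $Y:A\to\mathcal U$ the exo-type $\prod^e_{a:A}Y(a)$ is fibrant, and (2) in that case, if each $Y(a)$ is contractible (with respect to $=$), then so is the fibrant match of $\prod^e_{a:A}Y(a)$. If $A,B$ are fibrant exo-types with exo-isomorphisms $s_A:RA\to A$ and $r_B:B\to RB$ ($RA,RB:\mathcal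 U$), a map $f:A\to B$ is a fibrant-equivalence if $r_B\circ f\circ s_A:RA\to RB$ is an equivalence of types. An exo-type $A$ is sharp if it is cofibrant and there are a type $RA:\mathcal U$ and a map $r:A\to RA$ such that for any $Y:RA\to\mathcal U$ the precomposition map $(-\circ r):\prod_{c:RA}Y(c)\to\prod^e_{a:A}Y(r(a))$ is a fibrant-equivalence. For $N,L:\mathcal U^e$, $\mathsf{BinTree}^e(N,L):\mathcal U^e$ is the inductive exo-type with constructors $\mathsf{leaf}^e:L\to\mathsf{BinTree}^e(N,L)$ and $\mathsf{node}^e:\mathsf{BinTree}^e(N,L)\to N\to\mathsf{BinTree}^e(N,L)\to\mathsf{BinTree}^e(N,L)$. -}

{-# OPTIONS --with-K #-}

-- Two-level type theory, with Agda itself as the outer level and a structure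
-- of Tarski universes as the inner level:
--
--   * exo-types are Agda's types `Set ℓ`; ∏ᵉ, ∑ᵉ, +ᵉ, 𝟏ᵉ, 𝟎ᵉ, ℕᵉ are `(a : A) → B a`,
--     the standard library's `Σ`, `_⊎_`, `⊤`, `⊥`, `ℕ`, and =ᵉ is `_≡_`.  Uniqueness of
--     identity proofs for =ᵉ is Agda's K; function extensionality is the
--     field `funextᵉ` of `TwoLevelTheory`.
--   * types are the elements of `U ℓ`, and `El` regards a type as an exo-type.

module Defs where

open import Level using (Level; _⊔_; Setω) renaming (zero to lzero; suc to lsuc)
open import Data.Product using (_,_; proj₁; proj₂) renaming (Σ to Σᵉ)
open import Data.Unit using () renaming (⊤ to 𝟙ᵉ)
open import Function using (_∘_; id)
open import Relation.Binary.PropositionalEquality using (_≡_; refl; sym; subst; cong-app)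
open import Axiom.Extensionality.Propositional using (Extensionality)

infix 4 _≅_
infixr 2 _×ω_

record _≅_ {a b} (A : Set a) (B : Set b) : Set (a ⊔ b) where
  field
    to      : A → B
    from    : B → A
    to∘from : to ∘ from ≡ id
    from∘to : from ∘ to ≡ id

record _×ω_ (A B : Setω) : Setω where
  constructor _,ω_
  field
    fstω : A
    sndω : B

-- Judgmental equalities of the inner theory appear as exo-equalities.  The
-- types with a judgmental uniqueness rule (Π, Σ, 𝟙) are therefore exactly
-- exo-isomorphic to their outer counterparts, whereas 𝟘, +, ℕ and Id only
-- eliminate into types.
record InnerTypes : Setω where
  infixr 5 _+_
  field
    U  : (ℓ : Level) → Set (lsuc ℓ)
    El : ∀ {ℓ} → U ℓ → Set ℓ

    𝓤     : (ℓ : Level) → U (lsuc ℓ)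
    𝓤-iso : ∀ {ℓ} → El (𝓤 ℓ) ≅ U ℓ

    Lift     : ∀ {a} b → U a → U (a ⊔ b)
    Lift-iso : ∀ {a b} {A : U a} → El (Lift b A) ≅ El A

    Π     : ∀ {a b} (A : U a) → (El A → U b) → U (a ⊔ b)
    Π-iso : ∀ {a b} {A : U a} {B : El A → U b} →
            El (Π A B) ≅ ((x : El A) → El (B x))

    Σ     : ∀ {a b} (A : U a) → (El A → U b) → U (a ⊔ b)
    Σ-iso : ∀ {a b} {A : U a} {B : El A → U b} →
            El (Σ A B) ≅ Σᵉ (El A) (λ x → El (B x))

    𝟙     : U lzero
    𝟙-iso : El 𝟙 ≅ 𝟙ᵉ

    𝟘      : U lzero
    𝟘-elim : ∀ {c} (C : El 𝟘 → U c) (x : El 𝟘) → El (C x)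

    _+_    : ∀ {a b} → U a → U b → U (a ⊔ b)
    inl    : ∀ {a b} {A : U a} {B : U b} → El A → El (A + B)
    inr    : ∀ {a b} {A : U a} {B : U b} → El B → El (A + B)
    +-elim : ∀ {a b c} {A : U a} {B : U b} (C : El (A + B) → U c) →
             ((x : El A) → El (C (inl x))) → ((y : El B) → El (C (inr y))) →
             (z : El (A + B)) → El (C z)
    +-inl  : ∀ {a b c} {A : U a} {B : U b} (C : El (A + B) → U c)
             (f : (x : El A) → El (C (inl x))) (g : (y : El B) → El (C (inr y)))
             (x : El A) → +-elim C f g (inl x) ≡ f x
    +-inr  : ∀ {a b c} {A : U a} {B : U b} (C : El (A + B) → U c)
             (f : (x : El A) → El (C (inl x))) (g : (y : El B) → El (C (inr y)))
             (y : El B) → +-elim C f g (inr y) ≡ g y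

    Nat      : U lzero
    ze       : El Nat
    su       : El Nat → El Nat
    Nat-elim : ∀ {c} (C : El Nat → U c) →
               El (C ze) → ((n : El Nat) → El (C n) → El (C (su n))) →
               (n : El Nat) → El (C n)
    Nat-ze   : ∀ {c} (C : El Nat → U c)
               (z : El (C ze)) (s : (n : El Nat) → El (C n) → El (C (su n))) →
               Nat-elim C z s ze ≡ z
    Nat-su   : ∀ {c} (C : El Nat → U c)
               (z : El (C ze)) (s : (n : El Nat) → El (C n) → El (C (su n)))
               (n : El Nat) → Nat-elim C z s (su n) ≡ s n (Nat-elim C z s n)

    Id     : ∀ {a} (A : U a) → El A → El A → U a
    rfl    : ∀ {a} {A : U a} {x : El A} → El (Id A x x)
    J      : ∀ {a c} {A : U a} {x : El A} (C : (y : El A) → El (Id A x y) → U c) →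
             El (C x rfl) → {y : El A} (p : El (Id A x y)) → El (C y p)
    J-rfl  : ∀ {a c} {A : U a} {x : El A} (C : (y : El A) → El (Id A x y) → U c)
             (d : El (C x rfl)) → J C d rfl ≡ d

  module _ {ℓ : Level} where
    open _≅_ (𝓤-iso {ℓ}) public using () renaming (to to decode; from to encode)

  module _ {a b : Level} {A : U a} {B : El A → U b} where
    open _≅_ (Π-iso {A = A} {B = B}) public using () renaming (to to app; from to lam)
    open _≅_ (Σ-iso {A = A} {B = B}) public using () renaming (to to unpair; from to pair)

  isContr : ∀ {a} → U a → U a
  isContr A = Σ A λ x → Π A λ y → Id A x y

  fiber : ∀ {a b} {A : U a} {B : U b} → (El A → El B) → El B → U (a ⊔ b)
  fiber {A = A} {B} f y = Σ A λ x → Id B (f x) y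

  isEquiv : ∀ {a b} {A : U a} {B : U b} → (El A → El B) → U (a ⊔ b)
  isEquiv {A = A} {B} f = Π B λ y → isContr (fiber {A = A} {B} f y)

  infix 4 _≃_

  _≃_ : ∀ {a b} → U a → U b → U (a ⊔ b)
  A ≃ B = Σ (Π A λ _ → B) λ f → isEquiv {A = A} {B} (app f)

  id-isEquiv : ∀ {a} (A : U a) → El (isEquiv {A = A} {A} id)
  id-isEquiv A = lam λ y → pair (pair (y , rfl) , lam λ z →
    subst (λ w → El (Id (fiber {A = A} {A} id y) (pair (y , rfl)) w))
          (cong-app (_≅_.from∘to Σ-iso) z)
          (J (λ y′ p → Id (fiber {A = A} {A} id y′) (pair (y′ , rfl)) (pair (proj₁ (unpair z) , p)))
             rfl (proj₂ (unpair z))))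

  idEquiv : ∀ {a} (A : U a) → El (A ≃ A)
  idEquiv A = pair (lam id ,
    subst (λ f → El (isEquiv {A = A} {A} f)) (sym (cong-app (_≅_.to∘from Π-iso) id)) (id-isEquiv A))

  idToEquiv : ∀ {ℓ} {X Y : El (𝓤 ℓ)} → El (Id (𝓤 ℓ) X Y) → El (decode X ≃ decode Y)
  idToEquiv {X = X} = J (λ Y _ → decode X ≃ decode Y) (idEquiv (decode X))

record TwoLevelTheory : Setω where
  field
    innerTypes : InnerTypes

  open InnerTypes innerTypes public

  field
    univalence : ∀ {ℓ} (X Y : El (𝓤 ℓ)) →
                 El (isEquiv {A = Id (𝓤 ℓ) X Y} {decode X ≃ decode Y} idToEquiv)
    funextᵉ    : ∀ {a b} → Extensionality a b

module Notions (T : TwoLevelTheory) where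
  open TwoLevelTheory T

  record IsFibrant {a} (A : Set a) : Set (lsuc a) where
    field
      match : U a
      iso   : A ≅ El match

  open IsFibrant public

  El-isFibrant : ∀ {a} (A : U a) → IsFibrant (El A)
  El-isFibrant A = record
    { match = A
    ; iso   = record { to = id ; from = id ; to∘from = refl ; from∘to = refl }
    }

  -- The families Y range over every universe of the inner hierarchy.
  record IsCofibrant {a} (A : Set a) : Setω where
    field
      Π-isFibrant : ∀ {ℓ} (Y : A → U ℓ) → IsFibrant ((x : A) → El (Y x))
      Π-isContr   : ∀ {ℓ} (Y : A → U ℓ) → (∀ x → El (isContr (Y x))) →
                    El (isContr (match (Π-isFibrant Y)))

  open IsCofibrant public

  IsFibrantEquiv : ∀ {a b} {A : Set a} {B : Set b} →
                   IsFibrant A → IsFibrant B → (A → B) → Set (a ⊔ b)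
  IsFibrantEquiv FA FB f =
    El (isEquiv {A = match FA} {match FB} (_≅_.to (iso FB) ∘ f ∘ _≅_.from (iso FA)))

  record IsSharp {a} (A : Set a) : Setω where
    field
      isCofibrant : IsCofibrant A
      R           : U a
      r           : A → El R
      precomp     : ∀ {ℓ} (Y : El R → U ℓ) →
                    IsFibrantEquiv (El-isFibrant (Π R Y))
                                   (Π-isFibrant isCofibrant (λ x → Y (r x)))
                                   (λ g x → app g (r x))

data BinTreeᵉ {n l} (N : Set n) (L : Set l) : Set (n ⊔ l) where
  leafᵉ : L → BinTreeᵉ N L
  nodeᵉ : BinTreeᵉ N L → N → BinTreeᵉ N L → BinTreeᵉ N L

{-# OPTIONS --safe #-}
{-# OPTIONS --with-K #-}

-- Preorder traversal, with trees grouped by their number of nodes, turns BinTreeᵉ N L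
-- into Σ_{m : ℕ} F m 0, where each F m k is built from N and L by finitely many binary
-- sums and products; so it suffices that both notions are closed under these operations,
-- under Σ over ℕ and under exo-isomorphism.
--
-- For sharpness, "precomposition with r is an equivalence for every Y" is replaced by the
-- induction principle "every g : Πᵉ_a Y (r a) extends along r, up to Id", which only
-- concerns maps and is stable under composition.  It gives back the equivalence: pointwise
-- equality of two extensions is an instance of the same principle, and function
-- extensionality (from univalence for Π, from cofibrancy for Πᵉ) does the rest.
module Submission where

open import Level using (Level; _⊔_; Setω; lift; lower) renaming (Lift to Liftᵉ)
open import Data.Nat using (ℕ; zero; suc)
open import Data.Product using (_×_; _,_; proj₁; proj₂) renaming (Σ to Σᵉ)
open import Data.Sum using (_⊎_; inj₁; inj₂; [_,_])
open import Data.Unit using (tt)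
open import Data.Vec using (Vec; []; _∷_; head)
open import Function using (_∘_; id)
open import Relation.Binary.PropositionalEquality
  using (_≡_; refl; sym; trans; cong; cong₂; subst; cong-app; dcong)
open import Axiom.Extensionality.Propositional using (Extensionality)
open import Defs

open _≅_

private variable
  a b c d ℓ : Level

-- Exo-isomorphisms.

≅-sym : {A : Set a} {B : Set b} → A ≅ B → B ≅ A
≅-sym i = record { to = from i ; from = to i ; to∘from = from∘to i ; from∘to = to∘from i }

≅-trans : {A : Set a} {B : Set b} {C : Set c} → A ≅ B → B ≅ C → A ≅ C
≅-trans i j = record
  { to      = to j ∘ to i
  ; from    = from i ∘ from j
  ; to∘from = trans (cong (λ h → to j ∘ h ∘ from j) (to∘from i)) (to∘from j)
  ; from∘to = trans (cong (λ h → from i ∘ h ∘ to i) (from∘to j)) (from∘to i)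
  }

≅-Lift : {A : Set a} → A ≅ Liftᵉ ℓ A
≅-Lift = record { to = lift ; from = lower ; to∘from = refl ; from∘to = refl }

module _ {A : Set a} {B : Set b} (i : A ≅ B) (Y : B → Set c) where

  extend : ((x : A) → Y (to i x)) → (y : B) → Y y
  extend g y = subst Y (cong-app (to∘from i) y) (g (from i y))

  -- Once `from i (to i x)` is generalised to a variable `x′`, the remaining transport runs along a
  -- loop, which K turns into `refl`. No coherence between the two inverse laws enters.
  extend-to : (g : (x : A) → Y (to i x)) (x : A) → extend g (to i x) ≡ g x
  extend-to g x = go (cong-app (from∘to i) x) (cong-app (to∘from i) (to i x))
    where
    go : ∀ {x′} → x′ ≡ x → (p : to i x′ ≡ to i x) → subst Y p (g x′) ≡ g x
    go refl refl = refl

-- Binary exo-trees as preorder traversals.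

module Forests {n l} (N : Set n) (L : Set l) where

  -- The preorder traversals of sequences of k + 1 trees with m nodes altogether.
  Forest : ℕ → ℕ → Set (n ⊔ l)
  Forest zero    zero    = Liftᵉ n L
  Forest zero    (suc k) = L × Forest zero k
  Forest (suc m) zero    = N × Forest m 1
  Forest (suc m) (suc k) = (L × Forest (suc m) k) ⊎ (N × Forest m (suc (suc k)))

  private
    Tree : Set (n ⊔ l)
    Tree = BinTreeᵉ N L

    -- The split on the node count is there because `Forest m (suc k)` unfolds only once `m` is a
    -- constructor.
    pushLeaf : ∀ {k} → L → Σᵉ ℕ (λ m → Forest m k) → Σᵉ ℕ (λ m → Forest m (suc k))
    pushLeaf x (zero  , p) = zero , (x , p)
    pushLeaf x (suc m , p) = suc m , inj₁ (x , p)

    -- The new node takes the first two trees of the sequence as its subtrees, so the length drops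
    -- by one.
    pushNode : ∀ {k} → N → Σᵉ ℕ (λ m → Forest m (suc k)) → Σᵉ ℕ (λ m → Forest m k)
    pushNode {zero}  x (m , p) = suc m , (x , p)
    pushNode {suc k} x (m , p) = suc m , inj₂ (x , p)

    push : ∀ {k} → Tree → Σᵉ ℕ (λ m → Forest m k) → Σᵉ ℕ (λ m → Forest m (suc k))
    push (leafᵉ x)     f = pushLeaf x f
    push (nodeᵉ s x t) f = pushNode x (push s (push t f))

    -- A `Forest` always encodes at least one tree, so there is no empty sequence to `push` onto;
    -- the last tree of a sequence is written separately.
    single : Tree → Σᵉ ℕ (λ m → Forest m 0)
    single (leafᵉ x)     = zero , lift x
    single (nodeᵉ s x t) = pushNode x (push s (single t))

    write : ∀ {k} → Vec Tree (suc k) → Σᵉ ℕ (λ m → Forest m k)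
    write {zero}  (t ∷ []) = single t
    write {suc k} (t ∷ ts) = push t (write ts)

    graft : ∀ {k} → N → Vec Tree (suc (suc k)) → Vec Tree (suc k)
    graft x (s ∷ t ∷ ts) = nodeᵉ s x t ∷ ts

    -- The recursion is lexicographic in `(m , k)`: a leading leaf shortens the sequence, while a
    -- leading node lowers the node count and lengthens the sequence by one tree.
    read : ∀ m k → Forest m k → Vec Tree (suc k)
    read zero    zero    (lift x)       = leafᵉ x ∷ []
    read zero    (suc k) (x , p)        = leafᵉ x ∷ read zero k p
    read (suc m) zero    (x , p)        = graft x (read m 1 p)
    read (suc m) (suc k) (inj₁ (x , p)) = leafᵉ x ∷ read (suc m) k p
    read (suc m) (suc k) (inj₂ (x , p)) = graft x (read m (suc (suc k)) p)

    read′ : ∀ {k} → Σᵉ ℕ (λ m → Forest m k) → Vec Tree (suc k)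
    read′ (m , p) = read m _ p

    read-pushLeaf : ∀ {k} x (f : Σᵉ ℕ (λ m → Forest m k)) →
                    read′ (pushLeaf x f) ≡ leafᵉ x ∷ read′ f
    read-pushLeaf x (zero  , p) = refl
    read-pushLeaf x (suc m , p) = refl

    read-pushNode : ∀ {k} x (f : Σᵉ ℕ (λ m → Forest m (suc k))) →
                    read′ (pushNode x f) ≡ graft x (read′ f)
    read-pushNode {zero}  x f = refl
    read-pushNode {suc k} x f = refl

    read-push : ∀ {k} t (f : Σᵉ ℕ (λ m → Forest m k)) → read′ (push t f) ≡ t ∷ read′ f
    read-push (leafᵉ x)     f = read-pushLeaf x f
    read-push (nodeᵉ s x t) f =
      trans (read-pushNode x (push s (push t f)))
            (cong (graft x) (trans (read-push s (push t f)) (cong (s ∷_) (read-push t f))))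

    read-single : ∀ t → read′ (single t) ≡ t ∷ []
    read-single (leafᵉ x)     = refl
    read-single (nodeᵉ s x t) =
      trans (read-pushNode x (push s (single t)))
            (cong (graft x) (trans (read-push s (single t)) (cong (s ∷_) (read-single t))))

    write-leaf : ∀ {k} x (ts : Vec Tree (suc k)) → write (leafᵉ x ∷ ts) ≡ pushLeaf x (write ts)
    write-leaf x (t ∷ ts) = refl

    write-graft : ∀ {k} x (ts : Vec Tree (suc (suc k))) → write (graft x ts) ≡ pushNode x (write ts)
    write-graft {zero}  x (s ∷ t ∷ []) = refl
    write-graft {suc k} x (s ∷ t ∷ ts) = refl

    write-read : ∀ m k (p : Forest m k) → write (read m k p) ≡ (m , p)
    write-read zero    zero    (lift x)       = refl
    write-read zero    (suc k) (x , p)        =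
      trans (write-leaf x (read zero k p)) (cong (pushLeaf x) (write-read zero k p))
    write-read (suc m) zero    (x , p)        =
      trans (write-graft x (read m 1 p)) (cong (pushNode x) (write-read m 1 p))
    write-read (suc m) (suc k) (inj₁ (x , p)) =
      trans (write-leaf x (read (suc m) k p)) (cong (pushLeaf x) (write-read (suc m) k p))
    write-read (suc m) (suc k) (inj₂ (x , p)) =
      trans (write-graft x (read m _ p)) (cong (pushNode x) (write-read m _ p))

    single-head : (ts : Vec Tree 1) → single (head ts) ≡ write ts
    single-head (t ∷ []) = refl

  Forest≅BinTree : (∀ {a b} → Extensionality a b) → Σᵉ ℕ (λ m → Forest m 0) ≅ BinTreeᵉ N L
  Forest≅BinTree funext = record
    { to      = head ∘ read′
    ; from    = single
    ; to∘from = funext λ t → cong head (read-single t)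
    ; from∘to = funext λ (m , p) → trans (single-head (read m 0 p)) (write-read m 0 p)
    }

-- Identity types, contractibility and equivalences in the inner theory.

module InnerProperties (I : InnerTypes) where
  open InnerTypes I

  private variable
    A B : U ℓ

  -- A one-way bridge: `J` eliminates only into types, so it cannot turn `Id` back into
  -- exo-equality.
  ≡⇒Id : {x y : El A} → x ≡ y → El (Id A x y)
  ≡⇒Id refl = rfl

  ap : (f : El A → El B) {x y : El A} → El (Id A x y) → El (Id B (f x) (f y))
  ap {B = B} f {x} = J (λ y _ → Id B (f x) (f y)) rfl

  ap-rfl : (f : El A → El B) {x : El A} → ap {A = A} {B = B} f (rfl {x = x}) ≡ rfl
  ap-rfl {B = B} f {x} = J-rfl (λ y _ → Id B (f x) (f y)) rfl

  infixl 6 _∙_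

  _∙_ : {x y z : El A} → El (Id A x y) → El (Id A y z) → El (Id A x z)
  _∙_ {A = A} {x} p = J (λ z _ → Id A x z) p

  ∙-rfl : {x y : El A} (p : El (Id A x y)) → p ∙ rfl ≡ p
  ∙-rfl {A = A} {x} p = J-rfl (λ z _ → Id A x z) p

  inv : {x y : El A} → El (Id A x y) → El (Id A y x)
  inv {A = A} {x} = J (λ y _ → Id A y x) rfl

  inv-rfl : {x : El A} → inv (rfl {A = A} {x}) ≡ rfl
  inv-rfl {A = A} {x} = J-rfl (λ y _ → Id A y x) rfl

  ∙-inv : {x y : El A} (p : El (Id A x y)) → El (Id (Id A x x) (p ∙ inv p) rfl)
  ∙-inv {A = A} {x} = J (λ y p → Id (Id A x x) (p ∙ inv p) rfl)
    (≡⇒Id (trans (cong (rfl ∙_) inv-rfl) (∙-rfl rfl)))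

  inv-∙ : {x y : El A} (p : El (Id A x y)) → El (Id (Id A y y) (inv p ∙ p) rfl)
  inv-∙ {A = A} {x} = J (λ y p → Id (Id A y y) (inv p ∙ p) rfl)
    (≡⇒Id (trans (∙-rfl (inv rfl)) inv-rfl))

  module _ {A : U a} {B : El A → U b} where

    app-lam : (f : (x : El A) → El (B x)) → app (lam {B = B} f) ≡ f
    app-lam = cong-app (to∘from Π-iso)

    lam-app : (f : El (Π A B)) → lam (app f) ≡ f
    lam-app = cong-app (from∘to Π-iso)

    fst : El (Σ A B) → El A
    fst = proj₁ ∘ unpair

    snd : (z : El (Σ A B)) → El (B (fst z))
    snd z = proj₂ (unpair z)

    unpair-pair : (z : Σᵉ (El A) (λ x → El (B x))) → unpair (pair {B = B} z) ≡ z
    unpair-pair = cong-app (to∘from Σ-iso)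

    fst-pair : ∀ {x} {y : El (B x)} → fst (pair (x , y)) ≡ x
    fst-pair = cong proj₁ (unpair-pair _)

    Σ-elim : (C : El (Σ A B) → U c) →
             ((x : El A) (y : El (B x)) → El (C (pair (x , y)))) → ∀ z → El (C z)
    Σ-elim C g = extend (≅-sym Σ-iso) (El ∘ C) λ (x , y) → g x y

    pair-apʳ : ∀ {x} {y y′ : El (B x)} → El (Id (B x) y y′) →
               El (Id (Σ A B) (pair (x , y)) (pair (x , y′)))
    pair-apʳ {x} = ap (λ y → pair (x , y))

  contr : (x : El A) → (∀ y → El (Id A x y)) → El (isContr A)
  contr x p = pair (x , lam p)

  centre : El (isContr A) → El A
  centre = fst

  contraction : (k : El (isContr A)) → ∀ y → El (Id A (centre k) y)
  contraction k = app (snd k)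

  contr-path : El (isContr A) → (x y : El A) → El (Id A x y)
  contr-path k x y = inv (contraction k x) ∙ contraction k y

  contr-retract : (s : El A → El B) (r : El B → El A) → (∀ x → El (Id A (r (s x)) x)) →
                  El (isContr B) → El (isContr A)
  contr-retract {B = B} s r h k =
    contr (r (centre k)) λ x → ap {A = B} r (contraction k (s x)) ∙ h x

  contr-≅ : El A ≅ El B → El (isContr A) → El (isContr B)
  contr-≅ i = contr-retract (from i) (to i) (λ x → ≡⇒Id (cong-app (to∘from i) x))

  contr-× : El (isContr A) → El (isContr B) → El (isContr (Σ A λ _ → B))
  contr-× {A = A} {B = B} k h = contr (pair (centre k , centre h))
    (Σ-elim (λ z → Id (Σ A λ _ → B) (pair (centre k , centre h)) z) λ x y →
       ap (λ x → pair (x , centre h)) (contraction k x) ∙ pair-apʳ (contraction h y))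

  contr-singleton : (x : El A) → El (isContr (Σ A λ y → Id A x y))
  contr-singleton {A = A} x = contr (pair (x , rfl))
    (Σ-elim (λ z → Id (Σ A λ y → Id A x y) (pair (x , rfl)) z) λ y →
       J (λ y p → Id (Σ A λ y → Id A x y) (pair (x , rfl)) (pair (y , p))) rfl)

  contr-retract-Σ : {B : El A → U b} {C : El A → U c}
    (s : ∀ x → El (B x) → El (C x)) (r : ∀ x → El (C x) → El (B x)) →
    (∀ x y → El (Id (B x) (r x (s x y)) y)) →
    El (isContr (Σ A C)) → El (isContr (Σ A B))
  contr-retract-Σ {A = A} {B = B} {C = C} s r h = contr-retract S R
    (Σ-elim (λ z → Id (Σ A B) (R (S z)) z) λ x y →
      subst (λ z → El (Id (Σ A B) z (pair (x , y)))) (sym (RS x y)) (pair-apʳ (h x y)))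
    where
    S : El (Σ A B) → El (Σ A C)
    S z = pair (fst z , s _ (snd z))
    R : El (Σ A C) → El (Σ A B)
    R z = pair (fst z , r _ (snd z))
    -- Projections of a `pair` compute only up to `≡`, so the composite is first simplified at both
    -- pairs.
    RS : ∀ x y → R (S (pair (x , y))) ≡ pair (x , r x (s x y))
    RS x y = trans (cong (λ (x , y) → pair (x , r x y)) (unpair-pair (fst w , s _ (snd w))))
                   (cong (λ (x , y) → pair (x , r x (s x y))) (unpair-pair (x , y)))
      where w = pair (x , y)

  -- By naturality of ε, the fibre of f over y is a retract of the singleton of g y.
  isEquiv-quasiInverse : (f : El A → El B) (g : El B → El A) →
    (∀ x → El (Id A (g (f x)) x)) → (∀ y → El (Id B (f (g y)) y)) →
    El (isEquiv {A = A} {B} f)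
  isEquiv-quasiInverse {A = A} {B = B} f g η ε = lam λ y →
    contr-retract-Σ (φ y) (ψ y) (λ x → J (λ y p → Id (Id B (f x) y) (ψ y x (φ y x p)) p) (ψφ x))
                    (app (id-isEquiv A) (g y))
    where
    φ : ∀ y x → El (Id B (f x) y) → El (Id A x (g y))
    φ y x p = inv (η x) ∙ ap {A = B} {B = A} g p
    ψ : ∀ y x → El (Id A x (g y)) → El (Id B (f x) y)
    ψ y x q = inv (ε (f x)) ∙ ap {A = A} {B = B} f (η x ∙ q) ∙ ε y
    ψφ : ∀ x → El (Id (Id B (f x) (f x)) (ψ (f x) x (φ (f x) x rfl)) rfl)
    ψφ x =
      ≡⇒Id (cong (ψ (f x) x) (trans (cong (inv (η x) ∙_) (ap-rfl g)) (∙-rfl _)))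
      ∙ ap (λ q → inv (ε (f x)) ∙ ap {A = A} {B = B} f q ∙ ε (f x)) (∙-inv (η x))
      ∙ ≡⇒Id (cong (_∙ ε (f x)) (trans (cong (inv (ε (f x)) ∙_) (ap-rfl f)) (∙-rfl _)))
      ∙ inv-∙ (ε (f x))

  equiv : (f : El A → El B) → El (isEquiv {A = A} {B} f) → El (A ≃ B)
  equiv {A = A} {B = B} f e =
    pair (lam f , subst (λ f → El (isEquiv {A = A} {B} f)) (sym (app-lam f)) e)

  -- Both endpoint projections invert δ, so f and g become equal once the map
  -- x ↦ (f x , g x , h x) factors through δ.
  module PathSpace (B : U b) where

    Paths : U b
    Paths = Σ B λ y → Σ B λ z → Id B y z

    δ : El B → El Paths
    δ y = pair (y , pair (y , rfl))

    path : ∀ {y z} → El (Id B y z) → El Paths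
    path p = pair (_ , pair (_ , p))

    source target : El Paths → El B
    source = fst
    target w = fst (snd w)

    source-path : ∀ {y z} (p : El (Id B y z)) → source (path p) ≡ y
    source-path p = fst-pair

    target-path : ∀ {y z} (p : El (Id B y z)) → target (path p) ≡ z
    target-path p =
      trans (cong (λ (y , w) → fst {B = Id B y} w) (unpair-pair (_ , pair (_ , p)))) fst-pair

    δ-isEquiv : El (isEquiv {A = B} {Paths} δ)
    δ-isEquiv = isEquiv-quasiInverse δ source
      (λ y → ≡⇒Id (source-path rfl))
      (Σ-elim (λ w → Id Paths (δ (source w)) w) λ y →
        Σ-elim (λ v → Id Paths (δ (source (pair (y , v)))) (pair (y , v))) λ z →
          J (λ z p → Id Paths (δ (source (path p))) (path p)) (≡⇒Id (cong δ (source-path rfl))))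

module TheoryProperties (T : TwoLevelTheory) where
  open TwoLevelTheory T
  open Notions T
  open InnerProperties innerTypes

  private variable
    A B C : U ℓ

  -- Function extensionality from univalence.

  decode-encode : (A : U ℓ) → decode (encode A) ≡ A
  decode-encode = cong-app (to∘from 𝓤-iso)

  ua : (X Y : El (𝓤 ℓ)) (e : El (decode X ≃ decode Y)) →
       El (Σ (Id (𝓤 ℓ) X Y) λ p → Id (decode X ≃ decode Y) (idToEquiv p) e)
  ua X Y e = centre (app (univalence X Y) e)

  Factor : (A : U a) (C : U c) (h : El (Π A λ _ → B)) (u : El (Π C λ _ → B)) → U _
  Factor {B = B} A C h u =
    Σ (Π C λ _ → A) λ v → Id (Π C λ _ → B) (lam (app h ∘ app v)) u

  -- By univalence `e` may be replaced by some `idToEquiv p`, and `J` then reduces `p` to `rfl`.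
  -- There the map is the identity and `u` is its own lift.
  factor-decode : (X Y : El (𝓤 ℓ)) (e : El (decode X ≃ decode Y))
    (u : El (Π C λ _ → decode Y)) → El (Factor (decode X) C (fst e) u)
  factor-decode {C = C} X Y e u =
    J (λ e _ → Factor (decode X) C (fst e) u)
      -- The quantification over `u` sits inside the motive because the type of `u` varies with `Y`.
      (app (J (λ Y p → Π (Π C λ _ → decode Y) λ u → Factor (decode X) C (fst (idToEquiv p)) u)
              (lam base) (fst (ua X Y e))) u)
      (snd (ua X Y e))
    where
    fst-id : fst (idToEquiv (rfl {x = X})) ≡ lam id
    fst-id = trans (cong fst (J-rfl (λ Y _ → decode X ≃ decode Y) (idEquiv (decode X)))) fst-pair

    base : ∀ u → El (Factor (decode X) C (fst (idToEquiv (rfl {x = X}))) u)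
    base u = pair (u , ≡⇒Id (trans (cong (λ h → lam (app h ∘ app u)) fst-id)
                      (trans (cong (λ h → lam (h ∘ app u)) (app-lam id)) (lam-app u))))

  -- Matching on the equalities `decode (encode A) ≡ A`, with both sides made variable, reduces
  -- arbitrary types to decoded codes.
  factor : {A B : U ℓ} (e : El (A ≃ B)) (u : El (Π C λ _ → B)) → El (Factor A C (fst e) u)
  factor {ℓ} {C = C} {A} {B} = go (decode-encode A) (decode-encode B)
    where
    go : ∀ {X Y} {A B : U ℓ} → decode X ≡ A → decode Y ≡ B →
         (e : El (A ≃ B)) (u : El (Π C λ _ → B)) → El (Factor A C (fst e) u)
    go {X} {Y} refl refl = factor-decode X Y

  -- Voevodsky's argument: `x ↦ path (h x)` factors through the equivalence `δ` by way of `fst F`.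
  -- Since `source` and `target` both undo `δ`, `f` and `g` are both identified with `fst F`.
  funext-→ : (f g : El A → El B) → (∀ x → El (Id B (f x) (g x))) →
             El (Id (Π A λ _ → B) (lam f) (lam g))
  funext-→ {A = A} {B = B} f g h =
    inv (leg source f (λ x → source-path rfl) (λ x → source-path (h x)))
    ∙ leg target g (λ x → target-path rfl) (λ x → target-path (h x))
    where
    open PathSpace B
    u : El (Π A λ _ → Paths)
    u = lam λ x → path (h x)
    F : El (Factor B A (lam δ) u)
    F = subst (λ h → El (Factor B A h u)) fst-pair (factor (equiv δ δ-isEquiv) u)
    leg : (π : El Paths → El B) (k : El A → El B) → (∀ y → π (δ y) ≡ y) →
          (∀ x → π (path (h x)) ≡ k x) → El (Id (Π A λ _ → B) (fst F) (lam k))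
    leg π k πδ πu =
      ≡⇒Id (sym (trans (cong lam (funextᵉ λ x → trans (cong (λ f → π (f x)) (app-lam _))
               (trans (cong (λ f → π (f (app (fst F) x))) (app-lam δ)) (πδ _)))) (lam-app (fst F))))
      ∙ ap (λ w → lam (π ∘ app w)) (snd F)
      ∙ ≡⇒Id (cong lam (funextᵉ λ x → trans (cong (λ f → π (f x)) (app-lam _)) (πu x)))

  -- The constant maps at the two centres are mutually inverse.
  ua-contr : (A B : U ℓ) → El (isContr A) → El (isContr B) → El (Id (𝓤 ℓ) (encode A) (encode B))
  ua-contr A B k h = go (decode-encode A) (decode-encode B) k h
    where
    go : ∀ {X Y} {A B : U _} → decode X ≡ A → decode Y ≡ B →
         El (isContr A) → El (isContr B) → El (Id (𝓤 _) X Y)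
    go {X} {Y} refl refl k h =
      fst (ua X Y (equiv (λ _ → centre h) (isEquiv-quasiInverse _ (λ _ → centre k)
                                             (contraction k) (contraction h))))

  -- A family of contractible types equals the constant family 𝟙.
  Π-contr : (B : El A → U b) → (∀ x → El (isContr (B x))) → El (isContr (Π A B))
  Π-contr {A = A} {b} B k =
    subst (λ F → El (isContr (Π A F))) (decode-lam B)
      (J (λ F _ → isContr (Π A (decode ∘ app F)))
         (subst (λ F → El (isContr (Π A F))) (sym (decode-lam (λ _ → 𝟙′))) base)
         (funext-→ (λ _ → encode 𝟙′) (encode ∘ B) λ x → ua-contr 𝟙′ (B x) contr-𝟙′ (k x)))
    where
    decode-lam : (F : El A → U b) → decode ∘ app (lam (encode ∘ F)) ≡ F
    decode-lam F = trans (cong (decode ∘_) (app-lam _)) (funextᵉ λ x → decode-encode (F x))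

    𝟙′ : U b
    𝟙′ = Lift b 𝟙

    point : El 𝟙′
    point = from Lift-iso (from 𝟙-iso tt)

    point-unique : (x : El 𝟙′) → point ≡ x
    point-unique x = trans (cong (from Lift-iso) (cong-app (from∘to 𝟙-iso) (to Lift-iso x)))
                           (cong-app (from∘to Lift-iso) x)

    contr-𝟙′ : El (isContr 𝟙′)
    contr-𝟙′ = contr point λ x → ≡⇒Id (point-unique x)

    base : El (isContr (Π A λ _ → 𝟙′))
    base = contr (lam λ _ → point) λ f →
      ≡⇒Id (trans (cong lam (funextᵉ λ x → point-unique (app f x))) (lam-app f))

  -- Closure properties of cofibrant exo-types.

  Π-≅ : {A : Set a} {B : A → Set b} {C : A → Set c} →
        (∀ x → B x ≅ C x) → ((x : A) → B x) ≅ ((x : A) → C x)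
  Π-≅ i = record
    { to      = λ f x → to (i x) (f x)
    ; from    = λ f x → from (i x) (f x)
    ; to∘from = funextᵉ λ f → funextᵉ λ x → cong-app (to∘from (i x)) (f x)
    ; from∘to = funextᵉ λ f → funextᵉ λ x → cong-app (from∘to (i x)) (f x)
    }

  Π-reindex : {A : Set a} {B : Set b} (i : A ≅ B) (Y : B → Set c) →
              ((y : B) → Y y) ≅ ((x : A) → Y (to i x))
  Π-reindex i Y = record
    { to      = _∘ to i
    ; from    = extend i Y
    ; to∘from = funextᵉ λ g → funextᵉ λ x → extend-to i Y g x
    ; from∘to = funextᵉ λ f → funextᵉ λ y → dcong f (cong-app (to∘from i) y)
    }

  -- For a type, the second condition is weak function extensionality.
  El-isCofibrant : (A : U a) → IsCofibrant (El A)
  El-isCofibrant A .Π-isFibrant Y = record { match = Π A Y ; iso = ≅-sym Π-iso }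
  El-isCofibrant A .Π-isContr   Y = Π-contr Y

  ≅-isCofibrant : {A : Set a} {B : Set a} → A ≅ B → IsCofibrant A → IsCofibrant B
  ≅-isCofibrant i cA .Π-isFibrant Y = record
    { match = match (Π-isFibrant cA (Y ∘ to i))
    ; iso   = ≅-trans (Π-reindex i (El ∘ Y)) (iso (Π-isFibrant cA (Y ∘ to i)))
    }
  ≅-isCofibrant i cA .Π-isContr Y k = Π-isContr cA (Y ∘ to i) (k ∘ to i)

  -- Separate from `≅-isCofibrant` because the fibrant match has to move to a larger universe, by
  -- the inner `Lift`.
  Lift-isCofibrant : {A : Set a} → IsCofibrant A → IsCofibrant (Liftᵉ b A)
  Lift-isCofibrant {b = b} cA .Π-isFibrant Y = record
    { match = Lift b (match (Π-isFibrant cA (Y ∘ lift)))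
    ; iso   = ≅-trans (Π-reindex ≅-Lift (El ∘ Y))
                (≅-trans (iso (Π-isFibrant cA (Y ∘ lift))) (≅-sym Lift-iso))
    }
  Lift-isCofibrant cA .Π-isContr Y k =
    contr-≅ (≅-sym Lift-iso) (Π-isContr cA (Y ∘ lift) (k ∘ lift))

  -- By currying, matches are formed fibrewise over `B x` first; these form a family of types over
  -- `A`, to which cofibrancy of `A` applies.
  Σ-isCofibrant : {A : Set a} {B : A → Set b} →
                  IsCofibrant A → (∀ x → IsCofibrant (B x)) → IsCofibrant (Σᵉ A B)
  Σ-isCofibrant {A = A} {B} cA cB = record
    { Π-isFibrant = λ Y → record
        { match = match (outer Y)
        ; iso   = ≅-trans curry (≅-trans (Π-≅ λ x → iso (inner Y x)) (iso (outer Y)))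
        }
    ; Π-isContr = λ Y k → Π-isContr cA _ λ x → Π-isContr (cB x) _ λ y → k (x , y)
    }
    where
    inner : (Y : Σᵉ A B → U ℓ) → ∀ x → IsFibrant ((y : B x) → El (Y (x , y)))
    inner Y x = Π-isFibrant (cB x) λ y → Y (x , y)
    outer : (Y : Σᵉ A B → U ℓ) → IsFibrant ((x : A) → El (match (inner Y x)))
    outer Y = Π-isFibrant cA λ x → match (inner Y x)
    curry : {Y : Σᵉ A B → Set ℓ} → ((z : Σᵉ A B) → Y z) ≅ ((x : A) (y : B x) → Y (x , y))
    curry = record
      { to = λ f x y → f (x , y) ; from = λ f (x , y) → f x y ; to∘from = refl ; from∘to = refl }

  ⊎-isCofibrant : {A : Set a} {B : Set b} → IsCofibrant A → IsCofibrant B → IsCofibrant (A ⊎ B)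
  ⊎-isCofibrant {A = A} {B} cA cB = record
    { Π-isFibrant = λ Y → record
        { match = Σ (match (left Y)) λ _ → match (right Y)
        ; iso   = ≅-trans split (≅-trans (×-≅ (iso (left Y)) (iso (right Y))) (≅-sym Σ-iso))
        }
    ; Π-isContr = λ Y k → contr-× (Π-isContr cA _ (k ∘ inj₁)) (Π-isContr cB _ (k ∘ inj₂))
    }
    where
    left : (Y : A ⊎ B → U ℓ) → IsFibrant ((x : A) → El (Y (inj₁ x)))
    left Y = Π-isFibrant cA (Y ∘ inj₁)
    right : (Y : A ⊎ B → U ℓ) → IsFibrant ((y : B) → El (Y (inj₂ y)))
    right Y = Π-isFibrant cB (Y ∘ inj₂)
    split : {Y : A ⊎ B → Set ℓ} →
            ((z : A ⊎ B) → Y z) ≅ (((x : A) → Y (inj₁ x)) × ((y : B) → Y (inj₂ y)))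
    split = record
      { to      = λ f → f ∘ inj₁ , f ∘ inj₂
      ; from    = λ (f , g) → [ f , g ]
      ; to∘from = refl
      ; from∘to = funextᵉ λ f → funextᵉ λ { (inj₁ x) → refl ; (inj₂ y) → refl }
      }
    ×-≅ : ∀ {a b c d} {A : Set a} {B : Set b} {C : Set c} {D : Set d} →
          A ≅ C → B ≅ D → (A × B) ≅ (C × D)
    ×-≅ i j = record
      { to      = λ (x , y) → to i x , to j y
      ; from    = λ (x , y) → from i x , from j y
      ; to∘from = funextᵉ λ (x , y) → cong₂ _,_ (cong-app (to∘from i) x) (cong-app (to∘from j) y)
      ; from∘to = funextᵉ λ (x , y) → cong₂ _,_ (cong-app (from∘to i) x) (cong-app (from∘to j) y)
      }

  -- The singletons at `u x` are contractible, hence by cofibrancy so is the match of their product.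
  -- The sections `(u , rfl)` and `(v , h)` are therefore identified there, and first projections
  -- give the claim.
  Π-isFibrant-ext : {A : Set a} (cA : IsCofibrant A) (Y : A → U b)
    {u v : (x : A) → El (Y x)} → (∀ x → El (Id (Y x) (u x) (v x))) →
    El (Id (match (Π-isFibrant cA Y)) (to (iso (Π-isFibrant cA Y)) u) (to (iso (Π-isFibrant cA Y)) v))
  Π-isFibrant-ext cA Y {u} {v} h =
    ≡⇒Id (sym (proj-to u λ x → rfl)) ∙ ap proj (contr-path k _ _) ∙ ≡⇒Id (proj-to v h)
    where
    Z : ∀ x → U _
    Z x = Σ (Y x) λ y → Id (Y x) (u x) y
    F = iso (Π-isFibrant cA Y)
    G = iso (Π-isFibrant cA Z)
    k : El (isContr (match (Π-isFibrant cA Z)))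
    k = Π-isContr cA Z λ x → contr-singleton (u x)
    proj : El (match (Π-isFibrant cA Z)) → El (match (Π-isFibrant cA Y))
    proj m = to F λ x → fst (from G m x)
    proj-to : ∀ w (p : ∀ x → El (Id (Y x) (u x) (w x))) →
              proj (to G λ x → pair (w x , p x)) ≡ to F w
    proj-to w p = cong (to F) (trans (cong (λ z x → fst (z x)) (cong-app (from∘to G) _))
                                     (funextᵉ λ x → fst-pair))

  funext : {B : El A → U b} (f g : El (Π A B)) → (∀ x → El (Id (B x) (app f x) (app g x))) →
           El (Id (Π A B) f g)
  funext {A = A} {B = B} f g h =
    ≡⇒Id (sym (lam-app f)) ∙ Π-isFibrant-ext (El-isCofibrant A) B h ∙ ≡⇒Id (lam-app g)

  -- Induction along a map, and its relation to sharpness.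

  IsInductive : {A : Set a} {B : Set b} → (A → B) → Setω
  IsInductive {A = A} {B} f = ∀ {ℓ} (Y : B → U ℓ) (g : ∀ x → El (Y (f x))) →
    Σᵉ (∀ y → El (Y y)) λ h → ∀ x → El (Id (Y (f x)) (h (f x)) (g x))

  ∘-isInductive : {A : Set a} {B : Set b} {C : Set c} {f : B → C} {g : A → B} →
                  IsInductive f → IsInductive g → IsInductive (f ∘ g)
  ∘-isInductive {g = g} f-ind g-ind Y k =
    let h  , h-β  = g-ind (Y ∘ _) k
        h′ , h′-β = f-ind Y h
    in h′ , λ x → h′-β (g x) ∙ h-β x

  ≅-isInductive : {A : Set a} {B : Set b} (i : A ≅ B) → IsInductive (to i)
  ≅-isInductive i Y g = extend i (El ∘ Y) g , λ x → ≡⇒Id (extend-to i (El ∘ Y) g x)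

  -- Sections are extended along each `g x` first. Packed by `lam` into the types `Π (D c) …`, the
  -- results form a section that can be extended along `f`.
  Σ-isInductive : {A : Set a} {B : A → Set b} {f : A → El C} (D : El C → U d)
                  (g : ∀ x → B x → El (D (f x))) →
                  IsInductive f → (∀ x → IsInductive (g x)) →
                  IsInductive {A = Σᵉ A B} {El (Σ C D)} (λ (x , y) → pair (f x , g x y))
  Σ-isInductive {C = C} {f = f} D g f-ind g-ind =
    ∘-isInductive (≅-isInductive (≅-sym Σ-iso)) λ Y k →
      let inner x = g-ind x (λ z → Y (f x , z)) (λ y → k (x , y))
          h , h-β = f-ind (λ c → Π (D c) λ z → Y (c , z)) (λ x → lam (proj₁ (inner x)))
      in (λ (c , z) → app (h c) z) ,
         (λ (x , y) → ap (λ m → app m (g x y)) (h-β x)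
                      ∙ ≡⇒Id (cong-app (app-lam (proj₁ (inner x))) (g x y))
                      ∙ proj₂ (inner x) y)

  -- `+-elim` reaches only types, which suffices because `Y` takes values in `U`.
  ⊎-isInductive : {A : Set a} {B : Set b} {C : U c} {D : U d} {f : A → El C} {g : B → El D} →
                  IsInductive f → IsInductive g →
                  IsInductive {B = El (C + D)} [ inl ∘ f , inr ∘ g ]
  ⊎-isInductive {f = f} {g} f-ind g-ind Y k =
    let h₁ , β₁ = f-ind (Y ∘ inl) (k ∘ inj₁)
        h₂ , β₂ = g-ind (Y ∘ inr) (k ∘ inj₂)
    in +-elim Y h₁ h₂ ,
       λ { (inj₁ x) → ≡⇒Id (+-inl Y h₁ h₂ (f x)) ∙ β₁ x
         ; (inj₂ y) → ≡⇒Id (+-inr Y h₁ h₂ (g y)) ∙ β₂ y }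

  -- The extension is the centre of the fibre of precomposition over `g`; applying `from F` turns
  -- its identification in the match into pointwise ones.
  sharp⇒inductive : {A : Set a} (sA : IsSharp A) → IsInductive (IsSharp.r sA)
  sharp⇒inductive sA Y g =
    app m , λ x →
      ≡⇒Id (sym (cong-app (cong-app (from∘to F) _) x))
      ∙ ap (λ w → from F w x) (snd lifted)
      ∙ ≡⇒Id (cong-app (cong-app (from∘to F) g) x)
    where
    open IsSharp sA
    F = iso (Π-isFibrant isCofibrant (Y ∘ r))
    lifted = centre (app (precomp Y) (to F g))
    m = fst lifted

  inductive⇒sharp : {A : Set a} → IsCofibrant A → (R : U a) (r : A → El R) →
                    IsInductive r → IsSharp A
  inductive⇒sharp {A = A} cA R r ind = record
    { isCofibrant = cA
    ; R           = R
    ; r           = r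
    ; precomp     = λ Y →
        let F = iso (Π-isFibrant cA (Y ∘ r))
            back = λ w → ind Y (from F w)
        in isEquiv-quasiInverse _ (λ w → lam (proj₁ (back w)))
             -- Re-extending the restriction of `f` gives back `f`: `ind` is applied to the family
             -- of identity types between the two.
             (λ f → funext _ _ (proj₁ (ind
                (λ c → Id (Y c) (app (lam (proj₁ (back (to F (λ x → app f (r x)))))) c) (app f c))
                λ x → ≡⇒Id (cong-app (app-lam _) (r x))
                      ∙ proj₂ (back (to F (λ x → app f (r x)))) x
                      ∙ ≡⇒Id (cong-app (cong-app (from∘to F) _) x))))
             (λ w → Π-isFibrant-ext cA (Y ∘ r)
                      (λ x → ≡⇒Id (cong-app (app-lam _) (r x)) ∙ proj₂ (back w) x)
                    ∙ ≡⇒Id (cong-app (to∘from F) w))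
    }

  -- Induction on inner natural numbers from values at numerals.

  su^ : ℕ → El Nat → El Nat
  su^ zero    c = c
  -- The successor is added innermost, so that dropping the first entry of a sequence over `c` gives
  -- a sequence over `su c` by computation.
  su^ (suc k) c = su^ k (su c)

  -- Nat-elim is run on the types of sequences with entries in Y c, Y (su c), …,
  -- which cofibrancy of ℕ provides; its step drops the first entry.
  module NatSequences (cℕ : IsCofibrant ℕ) (Y : El Nat → U ℓ) (g : ∀ k → El (Y (su^ k ze))) where

    Tail : El Nat → U ℓ
    Tail c = match (Π-isFibrant cℕ λ k → Y (su^ k c))

    seq : ∀ {c} → El (Tail c) → ∀ k → El (Y (su^ k c))
    seq = from (iso (Π-isFibrant cℕ _))

    tail′ : ∀ {c} → (∀ k → El (Y (su^ k c))) → El (Tail c)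
    tail′ = to (iso (Π-isFibrant cℕ _))

    seq-tail : ∀ {c} (f : ∀ k → El (Y (su^ k c))) → seq (tail′ f) ≡ f
    seq-tail = cong-app (from∘to (iso (Π-isFibrant cℕ _)))

    step : ∀ c → El (Tail c) → El (Tail (su c))
    step c t = tail′ λ k → seq t (suc k)

    tails : ∀ c → El (Tail c)
    tails = Nat-elim Tail (tail′ g) step

    seq-ze : seq (tails ze) ≡ g
    seq-ze = trans (cong seq (Nat-ze Tail (tail′ g) step)) (seq-tail g)

    seq-su : ∀ c k → seq (tails (su c)) k ≡ seq (tails c) (suc k)
    seq-su c = cong-app (trans (cong seq (Nat-su Tail (tail′ g) step c)) (seq-tail _))

    -- At `c = ze` the right-hand side is entry `k` of `g`, which makes the first entries of `tails`
    -- the required section.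
    seq-su^ : ∀ k c → seq (tails (su^ k c)) 0 ≡ seq (tails c) k
    seq-su^ zero    c = refl
    seq-su^ (suc k) c = trans (seq-su^ k (su c)) (seq-su c k)

  numeral : ℕ → El Nat
  numeral k = su^ k ze

  -- The values at numerals are exact, not merely up to `Id`, so that a family of codes can be
  -- extended with its given members preserved strictly.
  numeral-elim : IsCofibrant ℕ → (Y : El Nat → U ℓ) (g : ∀ k → El (Y (numeral k))) →
                 Σᵉ (∀ c → El (Y c)) λ h → ∀ k → h (numeral k) ≡ g k
  numeral-elim cℕ Y g = (λ c → seq (tails c) 0) , λ k → trans (seq-su^ k ze) (cong-app seq-ze k)
    where open NatSequences cℕ Y g

  -- Models: the part of sharpness besides cofibrancy, and its closure properties.

  record Model {a} (A : Set a) : Setω where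
    field
      carrier     : U a
      model       : A → El carrier
      isInductive : IsInductive model

  open Model

  sharp⇒model : {A : Set a} → IsSharp A → Model A
  sharp⇒model sA .carrier     = IsSharp.R sA
  sharp⇒model sA .model       = IsSharp.r sA
  sharp⇒model sA .isInductive = sharp⇒inductive sA

  Lift-model : {A : Set a} → Model A → Model (Liftᵉ b A)
  Lift-model {b = b} mA .carrier     = Lift b (carrier mA)
  Lift-model         mA .model       = from Lift-iso ∘ model mA ∘ lower
  Lift-model         mA .isInductive =
    ∘-isInductive (≅-isInductive (≅-sym Lift-iso))
      (∘-isInductive (isInductive mA) (≅-isInductive (≅-sym ≅-Lift)))

  ×-model : {A : Set a} {B : Set b} → Model A → Model B → Model (A × B)
  ×-model mA mB .carrier     = Σ (carrier mA) λ _ → carrier mB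
  ×-model mA mB .model       = λ (x , y) → pair (model mA x , model mB y)
  ×-model mA mB .isInductive =
    Σ-isInductive _ (λ _ → model mB) (isInductive mA) (λ _ → isInductive mB)

  ⊎-model : {A : Set a} {B : Set b} → Model A → Model B → Model (A ⊎ B)
  ⊎-model mA mB .carrier     = carrier mA + carrier mB
  ⊎-model mA mB .model       = [ inl ∘ model mA , inr ∘ model mB ]
  ⊎-model mA mB .isInductive = ⊎-isInductive (isInductive mA) (isInductive mB)

  ≅-model : {A B : Set a} → A ≅ B → Model A → Model B
  ≅-model i mA .carrier     = carrier mA
  ≅-model i mA .model       = model mA ∘ from i
  ≅-model i mA .isInductive = ∘-isInductive (isInductive mA) (≅-isInductive (≅-sym i))

  module _ (cℕ : IsCofibrant ℕ) {B : ℕ → Set b} (mB : ∀ k → Model (B k)) where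

    private
      -- The carriers are indexed by the exo-type `ℕ`; taking `𝓤 b` as the target extends them to a
      -- family over `Nat`, as the inner `Σ` requires.
      codes : Σᵉ (El Nat → El (𝓤 b)) λ h → ∀ k → h (numeral k) ≡ encode (carrier (mB k))
      codes = numeral-elim cℕ (λ _ → 𝓤 b) λ k → encode (carrier (mB k))

      D : El Nat → U b
      D = decode ∘ proj₁ codes

      D-numeral : ∀ k → carrier (mB k) ≡ D (numeral k)
      D-numeral k = sym (trans (cong decode (proj₂ codes k)) (decode-encode _))

      cast : {C D : U b} → C ≡ D → El C ≅ El D
      cast refl = record { to = id ; from = id ; to∘from = refl ; from∘to = refl }

    Σℕ-model : Model (Σᵉ ℕ B)
    Σℕ-model .carrier     = Σ Nat D
    Σℕ-model .model       = λ (k , x) → pair (numeral k , to (cast (D-numeral k)) (model (mB k) x))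
    Σℕ-model .isInductive = Σ-isInductive D _
      (λ Y g → let h , h-β = numeral-elim cℕ Y g in h , λ k → ≡⇒Id (h-β k))
      (λ k → ∘-isInductive (≅-isInductive (cast (D-numeral k))) (isInductive (mB k)))

  -- Cofibrancy and sharpness of binary exo-trees.

  module _ (cℕ : IsCofibrant ℕ) {n l} (N : Set n) (L : Set l) where
    open Forests N L

    BinTree-isCofibrant : IsCofibrant N → IsCofibrant L → IsCofibrant (BinTreeᵉ N L)
    BinTree-isCofibrant cN cL =
      ≅-isCofibrant (Forest≅BinTree funextᵉ) (Σ-isCofibrant cℕ λ m → forest m 0)
      where
      forest : ∀ m k → IsCofibrant (Forest m k)
      forest zero    zero    = Lift-isCofibrant cL
      forest zero    (suc k) = Σ-isCofibrant cL λ _ → forest zero k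
      forest (suc m) zero    = Σ-isCofibrant cN λ _ → forest m 1
      forest (suc m) (suc k) =
        ⊎-isCofibrant (Σ-isCofibrant cL λ _ → forest (suc m) k)
                      (Σ-isCofibrant cN λ _ → forest m (suc (suc k)))

    BinTree-isSharp : IsSharp N → IsSharp L → IsSharp (BinTreeᵉ N L)
    BinTree-isSharp sN sL =
      inductive⇒sharp (BinTree-isCofibrant (IsSharp.isCofibrant sN) (IsSharp.isCofibrant sL))
                      (carrier tree) (model tree) (isInductive tree)
      where
      mN = sharp⇒model sN
      mL = sharp⇒model sL

      forest : ∀ m k → Model (Forest m k)
      forest zero    zero    = Lift-model mL
      forest zero    (suc k) = ×-model mL (forest zero k)
      forest (suc m) zero    = ×-model mN (forest m 1)
      forest (suc m) (suc k) =
        ⊎-model (×-model mL (forest (suc m) k)) (×-model mN (forest m (suc (suc k))))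

      tree : Model (BinTreeᵉ N L)
      tree = ≅-model (Forest≅BinTree funextᵉ) (Σℕ-model cℕ λ m → forest m 0)

corollary3p10 : (T : TwoLevelTheory) → let open Notions T in
    IsCofibrant ℕ →
    ∀ {n l} (N : Set n) (L : Set l) →
    (IsCofibrant N → IsCofibrant L → IsCofibrant (BinTreeᵉ N L))
    ×ω (IsSharp N → IsSharp L → IsSharp (BinTreeᵉ N L))
corollary3p10 T cℕ N L = BinTree-isCofibrant cℕ N L ,ω BinTree-isSharp cℕ N L
  where open TheoryProperties T
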